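{- Let $0\le\varepsilon\le1$, let $t\ge2$ be an integer, and let $G$ be a red-blue $K_n$. If $G$ is $\varepsilon$-unbalanced, then $G$ has at most $\left(1-\frac{\varepsilon^4}{4}\right)2n\left(\frac{n-1}{2}\right)^{t}$ alternating walks of length $t$.
   Context: A red-blue $K_n$ is a complete graph on vertex set $V$, $|V|=n$, each of whose edges is coloured red or blue; $d_R(x)$ is the number of red edges at $x$. $G$ is $\varepsilon$-balanced if $\sum_{x\in V}\left|d_R(x)-\frac{n-1}{2}\right|\le\varepsilon\binom n2$, and $\varepsilon$-unbalanced otherwise. A walk of length $t$ is an ordered tuple $(v_0,\ldots,v_t)$ of vertices with $v_{i-1}v_i$ an edge for all $i\in[t]$; it is alternating if $v_{i-1}v_i$ and $v_iv_{i+1}$ have different colours for each $i\in[t-1]$.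
   Formalization: The parameter ε is taken to be a rational number with 0 ≤ ε ≤ 1 rather than an arbitrary real number. -}

module Defs where

open import Data.Bool using (Bool; true; false; _∧_; not; if_then_else_)
open import Data.Nat as ℕ using (ℕ; zero; suc)
open import Data.Nat.Combinatorics using (_C_)
open import Data.Fin as Fin using (Fin)
open import Data.Vec using (Vec; []; _∷_)
open import Data.List as List using (List; []; _∷_; allFin; concatMap; filterᵇ; length)
open import Data.Integer using (+_)
open import Data.Rational as ℚ using (ℚ; _+_; _*_; _-_; ∣_∣; _<_; 0ℚ; 1ℚ)
open import Relation.Nullary.Decidable using (⌊_⌋)
open import Relation.Binary.PropositionalEquality using (_≡_)

-- A red-blue K_n: a colouring of the edges of the complete graph on Fin n.
-- colour x y ≡ true means "red", false means "blue"; the value on the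
-- diagonal (x = y) is irrelevant since there is no such edge.
record RedBlueK (n : ℕ) : Set where
  field
    colour : Fin n → Fin n → Bool
    symmetric : ∀ x y → colour x y ≡ colour y x
open RedBlueK public

ℕ→ℚ : ℕ → ℚ
ℕ→ℚ k = + k ℚ./ 1

_^ℚ_ : ℚ → ℕ → ℚ
q ^ℚ zero = 1ℚ
q ^ℚ suc k = q * (q ^ℚ k)

sumFin : ∀ {n} → (Fin n → ℚ) → ℚ
sumFin {n} f = List.foldr (λ x acc → f x + acc) 0ℚ (allFin n)

dR : ∀ {n} → RedBlueK n → Fin n → ℕ
dR {n} G x = length (filterᵇ (λ y → not ⌊ x Fin.≟ y ⌋ ∧ colour G x y) (allFin n))

imbalance : ∀ {n} → RedBlueK n → ℚ
imbalance {n} G = sumFin (λ x → ∣ ℕ→ℚ (dR G x) - ((ℕ→ℚ n - 1ℚ) * ℚ.½) ∣)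

Unbalanced : ∀ {n} → ℚ → RedBlueK n → Set
Unbalanced {n} ε G = ε * ℕ→ℚ (n C 2) < imbalance G

allTuples : (n k : ℕ) → List (Vec (Fin n) k)
allTuples n zero = [] ∷ []
allTuples n (suc k) = concatMap (λ v → List.map (v ∷_) (allTuples n k)) (allFin n)

isWalk : ∀ {n k} → Vec (Fin n) k → Bool
isWalk [] = true
isWalk (v ∷ []) = true
isWalk (u ∷ v ∷ rest) = not ⌊ u Fin.≟ v ⌋ ∧ isWalk (v ∷ rest)

isAlternating : ∀ {n k} → RedBlueK n → Vec (Fin n) k → Bool
isAlternating G [] = true
isAlternating G (v ∷ []) = true
isAlternating G (u ∷ v ∷ []) = true
isAlternating G (u ∷ v ∷ w ∷ rest) =
  not ⌊ colour G u v Data.Bool.≟ colour G v w ⌋ ∧ isAlternating G (v ∷ w ∷ rest)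
  where import Data.Bool

altWalkCount : ∀ {n} → RedBlueK n → ℕ → ℕ
altWalkCount {n} G t =
  length (filterᵇ (λ w → isWalk w ∧ isAlternating G w) (allTuples n (suc t)))

{-# OPTIONS --safe #-}
module Submission where

-- Let a_k^c(x) be the number of alternating walks of length k that start at x
-- with an edge of colour c, let d_c be the degree in colour c, h = (n - 1)/2,
-- and E_k = Σ_c Σ_x d_{c̄}(x) a_k^c(x)².  Cauchy-Schwarz over the c-neighbours
-- of x and d_R d_B ≤ h² give E_{k+1} ≤ h² E_k, while E_1 = 2h Σ_x d_R(x) d_B(x).
-- Cutting a walk of length q + 2 at its second edge writes the count as a sum
-- over edges xy of a_1(y) a_q(x), and by AM-GM
-- 2 h^{q+1} a_1 a_q ≤ h^{2q} a_1² + h² a_q², so it is at most 2 h^q Σ_x d_R d_B.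
-- Finally d_R d_B = h² - δ² with δ = d_R - h, and imbalance forces
-- Σ_x δ² ≥ ε² h² n, so the theorem even holds with ε² in place of ε⁴/4.

open import Defs
open import Data.Nat using (ℕ; _≤_; zero; suc; s≤s; z≤n)
open import Data.Rational using (ℚ; 0ℚ; 1ℚ; ½; _*_; _-_; _/_; _+_; -_; ∣_∣; mkℚ)
import Data.Rational as Q
import Data.Nat
import Data.Nat as ℕ
open import Data.Bool as Bool using (Bool; true; false; _∧_; not; if_then_else_)
open import Data.Bool.Properties using (∧-identityʳ; ∧-zeroʳ; not-involutive)
open import Data.Vec using (Vec; []; _∷_)
open import Data.Nat.Combinatorics using (_C_; nC1≡n; nCk+nC[k+1]≡[n+1]C[k+1])
open import Relation.Nullary using (yes; no)
open import Relation.Nullary.Decidable using (⌊_⌋)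
open import Data.Fin as Fin using (Fin; zero; suc)
open import Data.List as List using (List; []; _∷_; _++_; allFin; concatMap; filterᵇ; length)
open import Data.List.Properties using (map-tabulate)
import Data.Nat.Properties as ℕₚ
import Data.Integer as ℤ
import Data.Integer.Properties as ℤₚ
open import Data.Nat.Coprimality as Coprime using ()
open import Data.Sum using (inj₁; inj₂)
open import Data.Rational.Properties
open import Data.Empty using (⊥-elim)
open import Data.Rational.Solver using (module +-*-Solver)
open import Relation.Binary.PropositionalEquality
open +-*-Solver using (solve; _:+_; _:*_; _:-_; :-_; _:=_; con)

-- Finite rational sums over lists.

private variable
  A B : Set

-- The same fold as `sumFin`, so `imbalance` unfolds to it; the list is arbitrary because sums over
-- tuples occur as well.
∑ : List A → (A → ℚ) → ℚ
∑ xs f = List.foldr (λ x acc → f x + acc) 0ℚ xs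

∑-cong : ∀ (xs : List A) {f g} → (∀ x → f x ≡ g x) → ∑ xs f ≡ ∑ xs g
∑-cong []       f≡g = refl
∑-cong (x ∷ xs) f≡g = cong₂ _+_ (f≡g x) (∑-cong xs f≡g)

∑-mono : ∀ (xs : List A) {f g} → (∀ x → f x Q.≤ g x) → ∑ xs f Q.≤ ∑ xs g
∑-mono []       f≤g = ≤-refl
∑-mono (x ∷ xs) f≤g = +-mono-≤ (f≤g x) (∑-mono xs f≤g)

+-interchange : ∀ a b c d → (a + b) + (c + d) ≡ (a + c) + (b + d)
+-interchange = solve 4 (λ a b c d → (a :+ b) :+ (c :+ d) := (a :+ c) :+ (b :+ d)) refl

∑-+ : ∀ (xs : List A) f g → ∑ xs (λ x → f x + g x) ≡ ∑ xs f + ∑ xs g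
∑-+ []       f g = refl
∑-+ (x ∷ xs) f g = trans (cong (f x + g x +_) (∑-+ xs f g)) (+-interchange (f x) (g x) (∑ xs f) (∑ xs g))

∑-*ˡ : ∀ (xs : List A) c f → ∑ xs (λ x → c * f x) ≡ c * ∑ xs f
∑-*ˡ []       c f = sym (*-zeroʳ c)
∑-*ˡ (x ∷ xs) c f = trans (cong (c * f x +_) (∑-*ˡ xs c f)) (sym (*-distribˡ-+ c (f x) (∑ xs f)))

∑-*ʳ : ∀ (xs : List A) c f → ∑ xs (λ x → f x * c) ≡ ∑ xs f * c
∑-*ʳ xs c f = trans (∑-cong xs λ x → *-comm (f x) c) (trans (∑-*ˡ xs c f) (*-comm c (∑ xs f)))

∑-zero : ∀ (xs : List A) → ∑ xs (λ _ → 0ℚ) ≡ 0ℚ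
∑-zero []       = refl
∑-zero (x ∷ xs) = trans (+-identityˡ _) (∑-zero xs)

∑-swap : ∀ (xs : List A) (ys : List B) (f : A → B → ℚ) → ∑ xs (λ x → ∑ ys (λ y → f x y)) ≡ ∑ ys (λ y → ∑ xs (λ x → f x y))
∑-swap []       ys f = sym (∑-zero ys)
∑-swap (x ∷ xs) ys f = trans (cong (∑ ys (f x) +_) (∑-swap xs ys f)) (sym (∑-+ ys (f x) _))

∑-++ : ∀ (xs ys : List A) f → ∑ (xs ++ ys) f ≡ ∑ xs f + ∑ ys f
∑-++ []       ys f = sym (+-identityˡ _)
∑-++ (x ∷ xs) ys f = trans (cong (f x +_) (∑-++ xs ys f)) (sym (+-assoc (f x) _ _))

∑-map : ∀ (xs : List A) (g : A → B) f → ∑ (List.map g xs) f ≡ ∑ xs (λ x → f (g x))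
∑-map []       g f = refl
∑-map (x ∷ xs) g f = cong (f (g x) +_) (∑-map xs g f)

∑-concatMap : ∀ (xs : List A) (g : A → List B) f → ∑ (concatMap g xs) f ≡ ∑ xs (λ x → ∑ (g x) f)
∑-concatMap []       g f = refl
∑-concatMap (x ∷ xs) g f = trans (∑-++ (g x) (concatMap g xs) f) (cong (∑ (g x) f +_) (∑-concatMap xs g f))

∑-allFin : ∀ n (f : Fin (suc n) → ℚ) → ∑ (allFin (suc n)) f ≡ f zero + ∑ (allFin n) (λ x → f (suc x))
∑-allFin n f = cong (f zero +_) (trans (cong (λ xs → ∑ xs f) (sym (map-tabulate (λ x → x) suc))) (∑-map (allFin n) suc f))

-- Embedding the naturals into the rationals.

ℕ→ℚ-suc : ∀ k → ℕ→ℚ (suc k) ≡ 1ℚ + ℕ→ℚ k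
ℕ→ℚ-suc k = sym (begin
  -- The quotient by 1 is stuck on a gcd for open `k`; coprimality with 1 exposes a bare `mkℚ`,
  -- after which addition computes.
  1ℚ + ℕ→ℚ k                            ≡⟨ cong (1ℚ +_) (normalize-coprime k⊥1) ⟩
  1ℚ + mkℚ (ℤ.+ k) 0 k⊥1                ≡⟨⟩
  (ℤ.+ 1 ℤ.+ ℤ.+ k ℤ.* ℤ.+ 1) Q./ 1     ≡⟨ cong (λ i → (ℤ.+ 1 ℤ.+ i) Q./ 1) (ℤₚ.*-identityʳ (ℤ.+ k)) ⟩
  ℕ→ℚ (suc k)                           ∎)
  where
  open ≡-Reasoning
  k⊥1 = Coprime.sym (Coprime.1-coprimeTo k)

ℕ→ℚ-+ : ∀ j k → ℕ→ℚ (j ℕ.+ k) ≡ ℕ→ℚ j + ℕ→ℚ k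
ℕ→ℚ-+ zero    k = sym (+-identityˡ _)
ℕ→ℚ-+ (suc j) k = trans (ℕ→ℚ-suc (j ℕ.+ k)) (trans (cong (1ℚ +_) (ℕ→ℚ-+ j k))
  (trans (sym (+-assoc 1ℚ (ℕ→ℚ j) (ℕ→ℚ k))) (cong (_+ ℕ→ℚ k) (sym (ℕ→ℚ-suc j)))))

∑-const : ∀ n c → ∑ (allFin n) (λ _ → c) ≡ ℕ→ℚ n * c
∑-const zero    c = sym (*-zeroˡ c)
∑-const (suc n) c = trans (∑-allFin n (λ _ → c)) (trans (cong (c +_) (∑-const n c))
  (trans (solve 2 (λ c k → c :+ k :* c := (con 1ℚ :+ k) :* c) refl c (ℕ→ℚ n)) (cong (_* c) (sym (ℕ→ℚ-suc n)))))

-- Order lemmas and weighted Cauchy-Schwarz.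

0≤² : ∀ a → 0ℚ Q.≤ a * a
0≤² a with ≤-total 0ℚ a
... | inj₁ 0≤a = nonNegative⁻¹ _ {{nonNeg*nonNeg⇒nonNeg a {{Q.nonNegative 0≤a}} a {{Q.nonNegative 0≤a}}}}
... | inj₂ a≤0 = nonNegative⁻¹ _ {{nonPos*nonPos⇒nonPos a {{Q.nonPositive a≤0}} a {{Q.nonPositive a≤0}}}}

0≤* : ∀ {a b} → 0ℚ Q.≤ a → 0ℚ Q.≤ b → 0ℚ Q.≤ a * b
0≤* {a} {b} 0≤a 0≤b = nonNegative⁻¹ _ {{nonNeg*nonNeg⇒nonNeg a {{Q.nonNegative 0≤a}} b {{Q.nonNegative 0≤b}}}}

*-monoˡ-≤-0≤ : ∀ {a b} c → 0ℚ Q.≤ c → a Q.≤ b → c * a Q.≤ c * b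
*-monoˡ-≤-0≤ c 0≤c = *-monoˡ-≤-nonNeg c {{Q.nonNegative 0≤c}}

*-monoʳ-≤-0≤ : ∀ {a b} c → 0ℚ Q.≤ c → a Q.≤ b → a * c Q.≤ b * c
*-monoʳ-≤-0≤ c 0≤c = *-monoʳ-≤-nonNeg c {{Q.nonNegative 0≤c}}

≤-byDifference : ∀ {a b} d → 0ℚ Q.≤ d → a + d ≡ b → a Q.≤ b
≤-byDifference {a} d 0≤d refl = subst (Q._≤ a + d) (+-identityʳ a) (+-monoʳ-≤ a 0≤d)


∑-nonNeg : ∀ (xs : List A) {f} → (∀ x → 0ℚ Q.≤ f x) → 0ℚ Q.≤ ∑ xs f
∑-nonNeg xs {f} 0≤f = subst (Q._≤ ∑ xs f) (∑-zero xs) (∑-mono xs 0≤f)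

-- The second moment about `t`. In `cauchySchwarz`, `t` is the value of `f` at the head of the list.
∑-weightedSquares : ∀ (xs : List A) (w f : A → ℚ) t →
  ∑ xs (λ x → w x * ((f x - t) * (f x - t)))
    ≡ ∑ xs w * (t * t) + ∑ xs (λ x → w x * (f x * f x)) - (t + t) * ∑ xs (λ x → w x * f x)
∑-weightedSquares []       w f t = solve 1 (λ t → con 0ℚ := con 0ℚ :* (t :* t) :+ con 0ℚ :- (t :+ t) :* con 0ℚ) refl t
∑-weightedSquares (x ∷ xs) w f t = trans (cong (w x * ((f x - t) * (f x - t)) +_) (∑-weightedSquares xs w f t))
  (solve 6 (λ w f t W Q F →
      w :* ((f :- t) :* (f :- t)) :+ (W :* (t :* t) :+ Q :- (t :+ t) :* F)
        := (w :+ W) :* (t :* t) :+ (w :* (f :* f) :+ Q) :- (t :+ t) :* (w :* f :+ F))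
    refl (w x) (f x) t (∑ xs w) (∑ xs (λ x → w x * (f x * f x))) (∑ xs (λ x → w x * f x)))

-- Lagrange's identity, one element at a time: adding `x` raises the difference of the two sides by
-- exactly `w x` times the sum of `w y * (f y - f x)²` over the tail.
cauchySchwarz : ∀ (xs : List A) (w f : A → ℚ) → (∀ x → 0ℚ Q.≤ w x) →
  ∑ xs (λ x → w x * f x) * ∑ xs (λ x → w x * f x) Q.≤ ∑ xs w * ∑ xs (λ x → w x * (f x * f x))
cauchySchwarz []       w f 0≤w = ≤-refl
cauchySchwarz (x ∷ xs) w f 0≤w = begin
  (w x * f x + F) * (w x * f x + F)
    ≡⟨ solve 3 (λ w f F → (w :* f :+ F) :* (w :* f :+ F) := F :* F :+ (w :* f :* (w :* f) :+ w :* f :* F :+ w :* f :* F)) refl (w x) (f x) F ⟩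
  F * F + rest
    ≤⟨ +-monoˡ-≤ rest (cauchySchwarz xs w f 0≤w) ⟩
  W * S + rest
    ≤⟨ ≤-byDifference (w x * ∑ xs (λ y → w y * ((f y - f x) * (f y - f x))))
         (0≤* (0≤w x) (∑-nonNeg xs λ y → 0≤* (0≤w y) (0≤² (f y - f x))))
         (trans (cong (λ d → W * S + rest + w x * d) (∑-weightedSquares xs w f (f x)))
           (solve 5 (λ w f W S F →
               W :* S :+ (w :* f :* (w :* f) :+ w :* f :* F :+ w :* f :* F) :+ w :* (W :* (f :* f) :+ S :- (f :+ f) :* F)
                 := (w :+ W) :* (w :* (f :* f) :+ S))
             refl (w x) (f x) W S F)) ⟩
  (w x + W) * (w x * (f x * f x) + S) ∎
  where
  open ≤-Reasoning
  W = ∑ xs w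
  F = ∑ xs (λ x → w x * f x)
  S = ∑ xs (λ x → w x * (f x * f x))
  rest = w x * f x * (w x * f x) + w x * f x * F + w x * f x * F

-- Indicators, binomials and powers.

indicator : Bool → ℚ
indicator b = if b then 1ℚ else 0ℚ

0≤indicator : ∀ b → 0ℚ Q.≤ indicator b
0≤indicator true  = Q.*≤* (ℤ.+≤+ ℕ.z≤n)
0≤indicator false = ≤-refl

length-filterᵇ : ∀ (p : A → Bool) xs → ℕ→ℚ (length (filterᵇ p xs)) ≡ ∑ xs (λ x → indicator (p x))
length-filterᵇ p []       = refl
length-filterᵇ p (x ∷ xs) with p x
... | true  = trans (ℕ→ℚ-suc (length (filterᵇ p xs))) (cong (1ℚ +_) (length-filterᵇ p xs))
... | false = trans (length-filterᵇ p xs) (sym (+-identityˡ _))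

⌊suc≟suc⌋ : ∀ {n} (x y : Fin n) → ⌊ suc x Fin.≟ suc y ⌋ ≡ ⌊ x Fin.≟ y ⌋
⌊suc≟suc⌋ x y with x Fin.≟ y
... | yes _ = refl
... | no  _ = refl

⌊≟⌋-sym : ∀ {n} (x y : Fin n) → ⌊ x Fin.≟ y ⌋ ≡ ⌊ y Fin.≟ x ⌋
⌊≟⌋-sym zero    zero    = refl
⌊≟⌋-sym zero    (suc y) = refl
⌊≟⌋-sym (suc x) zero    = refl
⌊≟⌋-sym (suc x) (suc y) = trans (⌊suc≟suc⌋ x y) (trans (⌊≟⌋-sym x y) (sym (⌊suc≟suc⌋ y x)))

∑-≟ : ∀ {n} (x : Fin n) → ∑ (allFin n) (λ y → indicator ⌊ x Fin.≟ y ⌋) ≡ 1ℚ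
∑-≟ {suc n} zero    = trans (∑-allFin n (λ y → indicator ⌊ zero Fin.≟ y ⌋)) (cong (1ℚ +_) (∑-zero (allFin n)))
∑-≟ {suc n} (suc x) = trans (∑-allFin n (λ y → indicator ⌊ suc x Fin.≟ y ⌋))
  (trans (+-identityˡ _) (trans (∑-cong (allFin n) λ y → cong indicator (⌊suc≟suc⌋ x y)) (∑-≟ x)))

-- Induction by Pascal's rule. With h = (n - 1)/2 the right side is n h, so imbalance reads Σ|δ| > ε
-- n h.
ℕ→ℚ-C2 : ∀ n → ℕ→ℚ (n C 2) ≡ ℕ→ℚ n * ((ℕ→ℚ n - 1ℚ) * ½)
ℕ→ℚ-C2 zero    = refl
ℕ→ℚ-C2 (suc n) = begin
  ℕ→ℚ (suc n C 2)                              ≡⟨ cong ℕ→ℚ (sym (nCk+nC[k+1]≡[n+1]C[k+1] n 1)) ⟩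
  ℕ→ℚ (n C 1 ℕ.+ n C 2)                        ≡⟨ ℕ→ℚ-+ (n C 1) (n C 2) ⟩
  ℕ→ℚ (n C 1) + ℕ→ℚ (n C 2)                    ≡⟨ cong₂ _+_ (cong ℕ→ℚ (nC1≡n n)) (ℕ→ℚ-C2 n) ⟩
  ℕ→ℚ n + ℕ→ℚ n * ((ℕ→ℚ n - 1ℚ) * ½)           ≡⟨ solve 1 (λ k → k :+ k :* ((k :- con 1ℚ) :* con ½) := (con 1ℚ :+ k) :* ((con 1ℚ :+ k :- con 1ℚ) :* con ½)) refl (ℕ→ℚ n) ⟩
  (1ℚ + ℕ→ℚ n) * ((1ℚ + ℕ→ℚ n - 1ℚ) * ½)       ≡⟨ cong (λ k → k * ((k - 1ℚ) * ½)) (sym (ℕ→ℚ-suc n)) ⟩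
  ℕ→ℚ (suc n) * ((ℕ→ℚ (suc n) - 1ℚ) * ½)       ∎
  where open ≡-Reasoning

-- `agree true` reduces to the identity, so `adj true` unfolds to the very predicate that `dR`
-- counts.
agree : Bool → Bool → Bool
agree true  b = b
agree false b = not b

half : ℕ → ℚ
half n = (ℕ→ℚ n - 1ℚ) * ½

^ℚ-pos : ∀ {a} → 0ℚ Q.< a → ∀ k → 0ℚ Q.< a ^ℚ k
^ℚ-pos {a} 0<a zero    = positive⁻¹ 1ℚ
^ℚ-pos {a} 0<a (suc k) = positive⁻¹ _ {{pos*pos⇒pos a {{Q.positive 0<a}} (a ^ℚ k) {{Q.positive (^ℚ-pos 0<a k)}}}}

0≤ℕ→ℚ : ∀ k → 0ℚ Q.≤ ℕ→ℚ k
0≤ℕ→ℚ k = nonNegative⁻¹ (ℕ→ℚ k) {{normalize-nonNeg k 1}}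

∣p∣*∣p∣≡p*p : ∀ p → ∣ p ∣ * ∣ p ∣ ≡ p * p
∣p∣*∣p∣≡p*p p with ∣p∣≡p∨∣p∣≡-p p
... | inj₁ eq = cong₂ _*_ eq eq
... | inj₂ eq = trans (cong₂ _*_ eq eq) (solve 1 (λ p → (:- p) :* (:- p) := p :* p) refl p)

p≤q⇒0≤q-p : ∀ {p q} → p Q.≤ q → 0ℚ Q.≤ q - p
p≤q⇒0≤q-p {p} {q} p≤q = subst (Q._≤ q - p) (+-inverseʳ p) (+-monoˡ-≤ (- p) p≤q)

-- Adjacency and degrees in each colour.

module _ {n} (G : RedBlueK n) where

  V : List (Fin n)
  V = allFin n

  adj : Bool → Fin n → Fin n → ℚ
  adj c x y = indicator (not ⌊ x Fin.≟ y ⌋ ∧ agree c (colour G x y))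

  0≤adj : ∀ c x y → 0ℚ Q.≤ adj c x y
  0≤adj c x y = 0≤indicator (not ⌊ x Fin.≟ y ⌋ ∧ agree c (colour G x y))

  adj-sym : ∀ c x y → adj c x y ≡ adj c y x
  adj-sym c x y = cong₂ (λ a b → indicator (not a ∧ agree c b)) (⌊≟⌋-sym x y) (symmetric G x y)

  deg : Bool → Fin n → ℚ
  deg c x = ∑ V (adj c x)

  0≤deg : ∀ c x → 0ℚ Q.≤ deg c x
  0≤deg c x = ∑-nonNeg V (0≤adj c x)

  dR≡deg : ∀ x → ℕ→ℚ (dR G x) ≡ deg true x
  dR≡deg x = length-filterᵇ _ V

  -- Every `y` other than `x` is a neighbour in exactly one colour. The total n - 1 is kept as 2h,
  -- the form used in all later estimates.
  deg-red+blue : ∀ x → deg true x + deg false x ≡ half n + half n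
  deg-red+blue x = begin
    deg true x + deg false x
      ≡⟨ sym (∑-+ V (adj true x) (adj false x)) ⟩
    ∑ V (λ y → adj true x y + adj false x y)
      ≡⟨ ∑-cong V (λ y → split ⌊ x Fin.≟ y ⌋ (colour G x y)) ⟩
    ∑ V (λ y → 1ℚ + - 1ℚ * indicator ⌊ x Fin.≟ y ⌋)
      ≡⟨ ∑-+ V (λ _ → 1ℚ) (λ y → - 1ℚ * indicator ⌊ x Fin.≟ y ⌋) ⟩
    ∑ V (λ _ → 1ℚ) + ∑ V (λ y → - 1ℚ * indicator ⌊ x Fin.≟ y ⌋)
      ≡⟨ cong₂ _+_ (∑-const n 1ℚ) (trans (∑-*ˡ V (- 1ℚ) (λ y → indicator ⌊ x Fin.≟ y ⌋)) (cong (- 1ℚ *_) (∑-≟ x))) ⟩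
    ℕ→ℚ n * 1ℚ - 1ℚ
      ≡⟨ solve 1 (λ k → k :* con 1ℚ :- con 1ℚ := (k :- con 1ℚ) :* con ½ :+ (k :- con 1ℚ) :* con ½) refl (ℕ→ℚ n) ⟩
    half n + half n ∎
    where
    open ≡-Reasoning
    split : ∀ a b → indicator (not a ∧ b) + indicator (not a ∧ not b) ≡ 1ℚ + - 1ℚ * indicator a
    split true  b     = refl
    split false true  = refl
    split false false = refl

  -- Alternating walks by start vertex and first colour.

  walks : ℕ → Bool → Fin n → ℚ
  -- The empty walk counts once for either colour, which makes `walks 1` the degree and lets it
  -- serve as a neutral factor when walks are joined.
  walks zero    c x = 1ℚ
  walks (suc k) c x = ∑ V (λ y → adj c x y * walks k (not c) y)

  altWalk : ∀ {k} → Vec (Fin n) k → ℚ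
  altWalk w = indicator (isWalk w ∧ isAlternating G w)

  distinct : Fin n → Fin n → ℚ
  distinct u v = indicator (not ⌊ u Fin.≟ v ⌋)

  -- With a third vertex present, both tests peel off their first condition: u and v are distinct,
  -- and the colour changes at `v`.
  altWalk-∷ : ∀ {k} u v w (ws : Vec (Fin n) k) →
    altWalk (u ∷ v ∷ w ∷ ws) ≡
      distinct u v * (indicator (not ⌊ colour G u v Bool.≟ colour G v w ⌋) * altWalk (v ∷ w ∷ ws))
  altWalk-∷ u v w ws = regroup (not ⌊ u Fin.≟ v ⌋) (isWalk (v ∷ w ∷ ws)) (not ⌊ colour G u v Bool.≟ colour G v w ⌋) _
    where
    regroup : ∀ a b c d → indicator ((a ∧ b) ∧ (c ∧ d)) ≡ indicator a * (indicator c * indicator (b ∧ d))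
    regroup false b     c     d = sym (*-zeroˡ (indicator c * indicator (b ∧ d)))
    regroup true  true  true  d = sym (trans (*-identityˡ _) (*-identityˡ _))
    regroup true  true  false d = sym (trans (*-identityˡ _) (*-zeroˡ (indicator d)))
    regroup true  false c     d = sym (trans (*-identityˡ _) (*-zeroʳ (indicator c)))

  -- The first edge fixes the colour that must follow it at `v`. The factor `distinct u v` removes
  -- the diagonal, where `colour` has no meaning.
  altWalks-from : ∀ k u v →
    ∑ (allTuples n k) (λ ws → altWalk (u ∷ v ∷ ws)) ≡ distinct u v * walks k (not (colour G u v)) v
  altWalks-from zero    u v = trans (+-identityʳ _)
    (trans (cong indicator (trans (∧-identityʳ (d ∧ true)) (∧-identityʳ d))) (sym (*-identityʳ (indicator d))))
    where d = not ⌊ u Fin.≟ v ⌋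
  altWalks-from (suc k) u v = begin
    ∑ (allTuples n (suc k)) (λ ws → altWalk (u ∷ v ∷ ws))
      ≡⟨ ∑-concatMap V (λ w → List.map (w ∷_) (allTuples n k)) (λ ws → altWalk (u ∷ v ∷ ws)) ⟩
    ∑ V (λ w → ∑ (List.map (w ∷_) (allTuples n k)) (λ ws → altWalk (u ∷ v ∷ ws)))
      ≡⟨ ∑-cong V (λ w → ∑-map (allTuples n k) (w ∷_) (λ ws → altWalk (u ∷ v ∷ ws))) ⟩
    ∑ V (λ w → ∑ (allTuples n k) (λ ws → altWalk (u ∷ v ∷ w ∷ ws)))
      ≡⟨ ∑-cong V (λ w → trans (∑-cong (allTuples n k) (altWalk-∷ u v w))
           (trans (∑-*ˡ (allTuples n k) (distinct u v) _)
             (cong (distinct u v *_) (trans (∑-*ˡ (allTuples n k) (turn w) _)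
               (cong (turn w *_) (altWalks-from k v w)))))) ⟩
    ∑ V (λ w → distinct u v * (turn w * (distinct v w * walks k (not (colour G v w)) w)))
      ≡⟨ ∑-*ˡ V (distinct u v) _ ⟩
    distinct u v * ∑ V (λ w → turn w * (distinct v w * walks k (not (colour G v w)) w))
      ≡⟨ cong (distinct u v *_) (∑-cong V λ w → turn-adj (not ⌊ v Fin.≟ w ⌋) (colour G u v) (colour G v w) w) ⟩
    distinct u v * walks (suc k) (not (colour G u v)) v ∎
    where
    open ≡-Reasoning
    turn : Fin n → ℚ
    turn w = indicator (not ⌊ colour G u v Bool.≟ colour G v w ⌋)
    -- A colour change means `b` is `not a`, which allows the colour in the remaining walk to be
    -- rewritten; if `a` and `b` agree, both sides vanish.
    turn-adj : ∀ d a b w →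
      indicator (not ⌊ a Bool.≟ b ⌋) * (indicator d * walks k (not b) w)
        ≡ indicator (d ∧ agree (not a) b) * walks k (not (not a)) w
    turn-adj d true  true  w = trans (*-zeroˡ (indicator d * walks k false w))
      (trans (sym (*-zeroˡ (walks k true w))) (cong (λ e → indicator e * walks k true w) (sym (∧-zeroʳ d))))
    turn-adj d true  false w = trans (*-identityˡ _) (cong (λ e → indicator e * walks k true w) (sym (∧-identityʳ d)))
    turn-adj d false true  w = trans (*-identityˡ _) (cong (λ e → indicator e * walks k false w) (sym (∧-identityʳ d)))
    turn-adj d false false w = trans (*-zeroˡ (indicator d * walks k true w))
      (trans (sym (*-zeroˡ (walks k false w))) (cong (λ e → indicator e * walks k false w) (sym (∧-zeroʳ d))))

  -- The split is by the colour of the first edge. Positive length matters: the trivial walk would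
  -- be counted under both colours.
  altWalkCount≡∑walks : ∀ k → ℕ→ℚ (altWalkCount G (suc k)) ≡ ∑ V (walks (suc k) true) + ∑ V (walks (suc k) false)
  altWalkCount≡∑walks k = begin
    ℕ→ℚ (altWalkCount G (suc k))
      ≡⟨ length-filterᵇ _ (allTuples n (2 ℕ.+ k)) ⟩
    ∑ (allTuples n (2 ℕ.+ k)) altWalk
      ≡⟨ ∑-concatMap V _ altWalk ⟩
    ∑ V (λ u → ∑ (List.map (u ∷_) (allTuples n (suc k))) altWalk)
      ≡⟨ ∑-cong V (λ u → trans (∑-map (allTuples n (suc k)) (u ∷_) altWalk)
           (trans (∑-concatMap V _ (λ ws → altWalk (u ∷ ws)))
             (∑-cong V λ v → trans (∑-map (allTuples n k) (v ∷_) (λ ws → altWalk (u ∷ ws)))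
               (trans (altWalks-from k u v) (split (not ⌊ u Fin.≟ v ⌋) (colour G u v) v))))) ⟩
    ∑ V (λ u → ∑ V (λ v → adj true u v * walks k false v + adj false u v * walks k true v))
      ≡⟨ ∑-cong V (λ u → ∑-+ V (λ v → adj true u v * walks k false v) (λ v → adj false u v * walks k true v)) ⟩
    ∑ V (λ u → walks (suc k) true u + walks (suc k) false u)
      ≡⟨ ∑-+ V (walks (suc k) true) (walks (suc k) false) ⟩
    ∑ V (walks (suc k) true) + ∑ V (walks (suc k) false) ∎
    where
    open ≡-Reasoning
    split : ∀ d a v → indicator d * walks k (not a) v
      ≡ indicator (d ∧ a) * walks k false v + indicator (d ∧ not a) * walks k true v
    split false a     v = solve 3 (λ w r b → con 0ℚ :* w := con 0ℚ :* r :+ con 0ℚ :* b) refl (walks k (not a) v) (walks k false v) (walks k true v)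
    split true  true  v = solve 2 (λ r b → con 1ℚ :* r := con 1ℚ :* r :+ con 0ℚ :* b) refl (walks k false v) (walks k true v)
    split true  false v = solve 2 (λ r b → con 1ℚ :* b := con 0ℚ :* r :+ con 1ℚ :* b) refl (walks k false v) (walks k true v)

  -- Degree deviations and the decay of energy.

  h : ℚ
  h = half n

  δ : Fin n → ℚ
  δ x = deg true x - h

  -- The degrees are h + δ and h - δ, so their product is a difference of squares, the same for both
  -- colours.
  deg-product : ∀ c x → deg c x * deg (not c) x ≡ h * h - δ x * δ x
  deg-product true  x = begin
    r * b                              ≡⟨ solve 2 (λ r b → r :* b := r :* (r :+ b :- r)) refl r b ⟩
    r * (r + b - r)                    ≡⟨ cong (λ s → r * (s - r)) (deg-red+blue x) ⟩
    r * (h + h - r)                    ≡⟨ solve 2 (λ r h → r :* (h :+ h :- r) := h :* h :- (r :- h) :* (r :- h)) refl r h ⟩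
    h * h - δ x * δ x                  ∎
    where
    open ≡-Reasoning
    r = deg true x
    b = deg false x
  deg-product false x = trans (*-comm (deg false x) (deg true x)) (deg-product true x)

  deg-product-≤ : ∀ c x → deg c x * deg (not c) x Q.≤ h * h
  deg-product-≤ c x = ≤-byDifference (δ x * δ x) (0≤² (δ x))
    (trans (cong (_+ δ x * δ x) (deg-product c x)) (solve 2 (λ a b → a :- b :+ b := a) refl (h * h) (δ x * δ x)))

  -- The weight is the degree in the colour opposite to the first edge, that is, the number of ways
  -- to extend the walk backwards by one alternating edge.
  localEnergy : ℕ → Bool → Fin n → ℚ
  localEnergy k c x = deg (not c) x * (walks k c x * walks k c x)

  energy : ℕ → Bool → ℚ
  energy k c = ∑ V (localEnergy k c)

  -- Double counting: each `y` is reached from its `deg c y` neighbours.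
  ∑∑-adj : ∀ c (f : Fin n → ℚ) → ∑ V (λ x → ∑ V (λ y → adj c x y * f y)) ≡ ∑ V (λ y → deg c y * f y)
  ∑∑-adj c f = trans (∑-swap V V (λ x y → adj c x y * f y))
    (∑-cong V λ y → trans (∑-*ʳ V (f y) (λ x → adj c x y)) (cong (_* f y) (∑-cong V λ x → adj-sym c x y)))

  -- Cauchy-Schwarz over the `c`-neighbours costs a factor `deg c x`, which meets the weight
  -- `deg (not c) x` in a product of at most h². Exchanging the sums then gives each `y` the weight
  -- `deg c y`, right for walks that continue in the other colour.
  energy-step : ∀ k c → energy (suc k) c Q.≤ h * h * energy k (not c)
  energy-step k c = begin
    ∑ V (λ x → deg (not c) x * (walks (suc k) c x * walks (suc k) c x))
      ≤⟨ ∑-mono V (λ x → *-monoˡ-≤-0≤ (deg (not c) x) (0≤deg (not c) x) (cauchySchwarz V (adj c x) f (0≤adj c x))) ⟩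
    ∑ V (λ x → deg (not c) x * (deg c x * next x))
      ≡⟨ ∑-cong V (λ x → solve 3 (λ a b e → a :* (b :* e) := b :* a :* e) refl (deg (not c) x) (deg c x) (next x)) ⟩
    ∑ V (λ x → deg c x * deg (not c) x * next x)
      ≤⟨ ∑-mono V (λ x → *-monoʳ-≤-0≤ (next x) (∑-nonNeg V λ y → 0≤* (0≤adj c x y) (0≤² (f y))) (deg-product-≤ c x)) ⟩
    ∑ V (λ x → h * h * next x)
      ≡⟨ ∑-*ˡ V (h * h) next ⟩
    h * h * ∑ V next
      ≡⟨ cong (h * h *_) (∑∑-adj c (λ y → f y * f y)) ⟩
    h * h * ∑ V (λ y → deg c y * (f y * f y))
      ≡⟨ cong (λ d → h * h * ∑ V (λ y → deg d y * (f y * f y))) (sym (not-involutive c)) ⟩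
    h * h * energy k (not c) ∎
    where
    open ≤-Reasoning
    f = walks k (not c)
    next : Fin n → ℚ
    next x = ∑ V (λ y → adj c x y * (f y * f y))

  -- Σ d_R d_B, written through deg-product.
  redBlueCherries : ℚ
  redBlueCherries = ∑ V (λ x → h * h - δ x * δ x)

  walks-1 : ∀ c x → walks 1 c x ≡ deg c x
  walks-1 c x = ∑-cong V λ y → *-identityʳ (adj c x y)

  -- Adding the colours turns b r² + r b² into (r + b) r b, and r + b is 2h at every vertex.
  energy-1 : energy 1 true + energy 1 false ≡ (h + h) * redBlueCherries
  energy-1 = trans (sym (∑-+ V (localEnergy 1 true) (localEnergy 1 false))) (trans (∑-cong V pointwise) (∑-*ˡ V (h + h) _))
    where
    open ≡-Reasoning
    pointwise : ∀ x → deg false x * (walks 1 true x * walks 1 true x) + deg true x * (walks 1 false x * walks 1 false x)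
      ≡ (h + h) * (h * h - δ x * δ x)
    pointwise x = begin
      deg false x * (walks 1 true x * walks 1 true x) + deg true x * (walks 1 false x * walks 1 false x)
        ≡⟨ cong₂ (λ r b → deg false x * (r * r) + deg true x * (b * b)) (walks-1 true x) (walks-1 false x) ⟩
      deg false x * (deg true x * deg true x) + deg true x * (deg false x * deg false x)
        ≡⟨ solve 2 (λ r b → b :* (r :* r) :+ r :* (b :* b) := (r :+ b) :* (r :* b)) refl (deg true x) (deg false x) ⟩
      (deg true x + deg false x) * (deg true x * deg false x)
        ≡⟨ cong₂ _*_ (deg-red+blue x) (deg-product true x) ⟩
      (h + h) * (h * h - δ x * δ x) ∎

  -- `energy-step` exchanges the colours, so the sum over both is what iterates down to `energy-1`.
  energy-≤ : ∀ q → energy (suc q) true + energy (suc q) false Q.≤ (h ^ℚ q) * (h ^ℚ q) * ((h + h) * redBlueCherries)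
  energy-≤ zero    = ≤-reflexive (trans energy-1 (sym (*-identityˡ _)))
  energy-≤ (suc q) = begin
    energy (2 ℕ.+ q) true + energy (2 ℕ.+ q) false
      ≤⟨ +-mono-≤ (energy-step (suc q) true) (energy-step (suc q) false) ⟩
    h * h * energy (suc q) false + h * h * energy (suc q) true
      ≡⟨ solve 3 (λ h r b → h :* h :* b :+ h :* h :* r := h :* h :* (r :+ b)) refl h (energy (suc q) true) (energy (suc q) false) ⟩
    h * h * (energy (suc q) true + energy (suc q) false)
      ≤⟨ *-monoˡ-≤-0≤ (h * h) (0≤² h) (energy-≤ q) ⟩
    h * h * ((h ^ℚ q) * (h ^ℚ q) * ((h + h) * redBlueCherries))
      ≡⟨ solve 3 (λ h p e → h :* h :* (p :* p :* e) := h :* p :* (h :* p) :* e) refl h (h ^ℚ q) ((h + h) * redBlueCherries) ⟩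
    (h ^ℚ suc q) * (h ^ℚ suc q) * ((h + h) * redBlueCherries) ∎
    where open ≤-Reasoning

  -- Cutting walks at a vertex or an edge, and the AM-GM bound.

  concatCount : ℕ → ℕ → Bool → ℚ
  -- Two walks leaving `x` in different colours join there into an alternating walk of length p + q.
  concatCount p q c = ∑ V (λ x → walks p c x * walks q (not c) x)

  -- Walks whose edge xy of colour c has q edges on the side of x and p on the side of y.
  bridgeCount : ℕ → ℕ → Bool → ℚ
  bridgeCount p q c = ∑ V (λ x → ∑ V (λ y → adj c x y * (walks p (not c) y * walks q (not c) x)))

  concatCount-sucˡ : ∀ p q c → concatCount (suc p) q c ≡ bridgeCount p q c
  concatCount-sucˡ p q c = ∑-cong V λ x → trans (sym (∑-*ʳ V (walks q (not c) x) (λ y → adj c x y * walks p (not c) y)))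
    (∑-cong V λ y → *-assoc (adj c x y) (walks p (not c) y) (walks q (not c) x))

  -- The bridge now belongs to the other side: read from `y`, it is the first edge of the longer
  -- walk towards `x`. Symmetry of `adj` identifies the two readings.
  concatCount-sucʳ : ∀ p q c → concatCount p (suc q) (not c) ≡ bridgeCount p q c
  concatCount-sucʳ p q c = begin
    ∑ V (λ y → walks p (not c) y * walks (suc q) (not (not c)) y)
      ≡⟨ cong (λ d → ∑ V (λ y → walks p (not c) y * walks (suc q) d y)) (not-involutive c) ⟩
    ∑ V (λ y → walks p (not c) y * walks (suc q) c y)
      ≡⟨ ∑-cong V (λ y → sym (∑-*ˡ V (walks p (not c) y) _)) ⟩
    ∑ V (λ y → ∑ V (λ x → walks p (not c) y * (adj c y x * walks q (not c) x)))
      ≡⟨ ∑-swap V V (λ y x → walks p (not c) y * (adj c y x * walks q (not c) x)) ⟩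
    ∑ V (λ x → ∑ V (λ y → walks p (not c) y * (adj c y x * walks q (not c) x)))
      ≡⟨ ∑-cong V (λ x → ∑-cong V λ y → trans (cong (λ e → walks p (not c) y * (e * walks q (not c) x)) (adj-sym c y x))
           (solve 3 (λ a e b → a :* (e :* b) := e :* (a :* b)) refl (walks p (not c) y) (adj c x y) (walks q (not c) x))) ⟩
    bridgeCount p q c ∎
    where open ≡-Reasoning

  -- The cut vertex slides across one bridge. This flips the colour, so the equality is for the sum
  -- over both colours.
  concatCount-shift : ∀ p q → concatCount (suc p) q true + concatCount (suc p) q false
    ≡ concatCount p (suc q) true + concatCount p (suc q) false
  concatCount-shift p q = begin
    concatCount (suc p) q true + concatCount (suc p) q false
      ≡⟨ cong₂ _+_ (trans (concatCount-sucˡ p q true) (sym (concatCount-sucʳ p q true)))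
                   (trans (concatCount-sucˡ p q false) (sym (concatCount-sucʳ p q false))) ⟩
    concatCount p (suc q) false + concatCount p (suc q) true
      ≡⟨ +-comm (concatCount p (suc q) false) (concatCount p (suc q) true) ⟩
    concatCount p (suc q) true + concatCount p (suc q) false ∎
    where open ≡-Reasoning

  concatCount-shift⋆ : ∀ p q r → concatCount (q ℕ.+ p) r true + concatCount (q ℕ.+ p) r false
    ≡ concatCount p (q ℕ.+ r) true + concatCount p (q ℕ.+ r) false
  concatCount-shift⋆ p zero    r = refl
  concatCount-shift⋆ p (suc q) r = trans (concatCount-shift (q ℕ.+ p) r) (trans (concatCount-shift⋆ p q (suc r))
    (cong (λ s → concatCount p s true + concatCount p s false) (ℕₚ.+-suc q r)))

  -- A whole walk is cut at its start, with an empty walk on the other side; the cut then slides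
  -- along `q` edges.
  altWalkCount≡concatCount : ∀ q p → ℕ→ℚ (altWalkCount G (q ℕ.+ suc p)) ≡ concatCount (suc p) q true + concatCount (suc p) q false
  altWalkCount≡concatCount q p = begin
    ℕ→ℚ (altWalkCount G (q ℕ.+ suc p))
      ≡⟨ cong (λ t → ℕ→ℚ (altWalkCount G t)) (ℕₚ.+-suc q p) ⟩
    ℕ→ℚ (altWalkCount G (suc (q ℕ.+ p)))
      ≡⟨ altWalkCount≡∑walks (q ℕ.+ p) ⟩
    ∑ V (walks (suc (q ℕ.+ p)) true) + ∑ V (walks (suc (q ℕ.+ p)) false)
      ≡⟨ cong₂ _+_ (unit true) (unit false) ⟩
    concatCount (suc (q ℕ.+ p)) 0 true + concatCount (suc (q ℕ.+ p)) 0 false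
      ≡⟨ cong (λ s → concatCount s 0 true + concatCount s 0 false) (sym (ℕₚ.+-suc q p)) ⟩
    concatCount (q ℕ.+ suc p) 0 true + concatCount (q ℕ.+ suc p) 0 false
      ≡⟨ concatCount-shift⋆ (suc p) q 0 ⟩
    concatCount (suc p) (q ℕ.+ 0) true + concatCount (suc p) (q ℕ.+ 0) false
      ≡⟨ cong (λ s → concatCount (suc p) s true + concatCount (suc p) s false) (ℕₚ.+-identityʳ q) ⟩
    concatCount (suc p) q true + concatCount (suc p) q false ∎
    where
    open ≡-Reasoning
    unit : ∀ c → ∑ V (walks (suc (q ℕ.+ p)) c) ≡ concatCount (suc (q ℕ.+ p)) 0 c
    unit c = ∑-cong V λ x → sym (*-identityʳ (walks (suc (q ℕ.+ p)) c x))

  -- On each bridge 2st uv ≤ t²u² + s²v², from the square of tu - sv. Each square, summed over the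
  -- opposite end, acquires the weight `deg c`. The free scales `s` and `t` avoid division.
  bridgeCount-≤ : ∀ p q c s t →
    (s * t + s * t) * bridgeCount p q c Q.≤ t * t * energy p (not c) + s * s * energy q (not c)
  bridgeCount-≤ p q c s t = begin
    (s * t + s * t) * bridgeCount p q c
      ≡⟨ sym (∑∑-*ˡ (s * t + s * t) _) ⟩
    ∑ V (λ x → ∑ V (λ y → (s * t + s * t) * (adj c x y * (f y * g x))))
      ≤⟨ ∑-mono V (λ x → ∑-mono V λ y → pointwise (adj c x y) (f y) (g x) (0≤adj c x y)) ⟩
    ∑ V (λ x → ∑ V (λ y → t * t * (adj c x y * (f y * f y)) + s * s * (adj c x y * (g x * g x))))
      ≡⟨ trans (∑-cong V λ x → ∑-+ V (λ y → t * t * (adj c x y * (f y * f y))) (λ y → s * s * (adj c x y * (g x * g x)))) 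
           (∑-+ V (λ x → ∑ V (λ y → t * t * (adj c x y * (f y * f y)))) (λ x → ∑ V (λ y → s * s * (adj c x y * (g x * g x))))) ⟩
    ∑ V (λ x → ∑ V (λ y → t * t * (adj c x y * (f y * f y)))) + ∑ V (λ x → ∑ V (λ y → s * s * (adj c x y * (g x * g x))))
      ≡⟨ cong₂ _+_ (∑∑-*ˡ (t * t) _) (∑∑-*ˡ (s * s) _) ⟩
    t * t * ∑ V (λ x → ∑ V (λ y → adj c x y * (f y * f y))) + s * s * ∑ V (λ x → ∑ V (λ y → adj c x y * (g x * g x)))
      ≡⟨ cong₂ (λ a b → t * t * a + s * s * b) (∑∑-adj c (λ y → f y * f y)) (∑-cong V λ x → ∑-*ʳ V (g x * g x) (adj c x)) ⟩
    t * t * ∑ V (λ y → deg c y * (f y * f y)) + s * s * ∑ V (λ x → deg c x * (g x * g x))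
      ≡⟨ cong (λ d → t * t * ∑ V (λ y → deg d y * (f y * f y)) + s * s * ∑ V (λ x → deg d x * (g x * g x))) (sym (not-involutive c)) ⟩
    t * t * energy p (not c) + s * s * energy q (not c) ∎
    where
    open ≤-Reasoning
    f = walks p (not c)
    g = walks q (not c)
    ∑∑-*ˡ : ∀ k (m : Fin n → Fin n → ℚ) → ∑ V (λ x → ∑ V (λ y → k * m x y)) ≡ k * ∑ V (λ x → ∑ V (λ y → m x y))
    ∑∑-*ˡ k m = trans (∑-cong V λ x → ∑-*ˡ V k (m x)) (∑-*ˡ V k (λ x → ∑ V (m x)))
    pointwise : ∀ e u v → 0ℚ Q.≤ e → (s * t + s * t) * (e * (u * v)) Q.≤ t * t * (e * (u * u)) + s * s * (e * (v * v))
    pointwise e u v 0≤e = ≤-byDifference (e * ((t * u - s * v) * (t * u - s * v))) (0≤* 0≤e (0≤² (t * u - s * v)))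
      (solve 5 (λ e s t u v → (s :* t :+ s :* t) :* (e :* (u :* v)) :+ e :* ((t :* u :- s :* v) :* (t :* u :- s :* v))
          := t :* t :* (e :* (u :* u)) :+ s :* s :* (e :* (v :* v))) refl e s t u v)

  altWalkCount-≤ : 0ℚ Q.< h → ∀ q → ℕ→ℚ (altWalkCount G (q ℕ.+ 2)) Q.≤ ((h ^ℚ q) + (h ^ℚ q)) * redBlueCherries
  -- Cut at the middle vertex, walks of length 2 are counted exactly.
  altWalkCount-≤ 0<h zero = ≤-reflexive (begin
    ℕ→ℚ (altWalkCount G 2)
      ≡⟨ altWalkCount≡concatCount 1 0 ⟩
    concatCount 1 1 true + concatCount 1 1 false
      ≡⟨ cong₂ _+_ (∑-cong V (degrees true)) (∑-cong V (degrees false)) ⟩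
    redBlueCherries + redBlueCherries
      ≡⟨ solve 1 (λ d → d :+ d := (con 1ℚ :+ con 1ℚ) :* d) refl redBlueCherries ⟩
    (1ℚ + 1ℚ) * redBlueCherries ∎)
    where
    open ≡-Reasoning
    degrees : ∀ c x → walks 1 c x * walks 1 (not c) x ≡ h * h - δ x * δ x
    degrees c x = trans (cong₂ _*_ (walks-1 c x) (walks-1 (not c) x)) (deg-product c x)
  -- The bound is proved after multiplication by `k`, that is 2hT, which `0<h` allows to be
  -- cancelled.
  altWalkCount-≤ 0<h (suc q) = *-cancelˡ-≤-pos k {{pos+pos⇒pos (h * T) {{hT⁺}} (h * T) {{hT⁺}}}} (begin
    k * ℕ→ℚ (altWalkCount G (suc q ℕ.+ 2))
      ≡⟨ cong (k *_) (trans (altWalkCount≡concatCount (suc q) 1)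
           (cong₂ _+_ (concatCount-sucˡ 1 (suc q) true) (concatCount-sucˡ 1 (suc q) false))) ⟩
    k * (bridgeCount 1 (suc q) true + bridgeCount 1 (suc q) false)
      ≡⟨ *-distribˡ-+ k _ _ ⟩
    k * bridgeCount 1 (suc q) true + k * bridgeCount 1 (suc q) false
      -- These scales balance the two terms: since E_{q+1} ≤ h^{2q} E_1, both are at most T² E_1.
      ≤⟨ +-mono-≤ (bridgeCount-≤ 1 (suc q) true h T) (bridgeCount-≤ 1 (suc q) false h T) ⟩
    (T * T * energy 1 false + h * h * energy (suc q) false) + (T * T * energy 1 true + h * h * energy (suc q) true)
      ≡⟨ solve 6 (λ t h b₁ b r₁ r → (t :* t :* b₁ :+ h :* h :* b) :+ (t :* t :* r₁ :+ h :* h :* r)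
            := t :* t :* (r₁ :+ b₁) :+ h :* h :* (r :+ b))
          refl T h (energy 1 false) (energy (suc q) false) (energy 1 true) (energy (suc q) true) ⟩
    T * T * (energy 1 true + energy 1 false) + h * h * (energy (suc q) true + energy (suc q) false)
      ≤⟨ +-mono-≤ (≤-reflexive (cong (T * T *_) energy-1)) (*-monoˡ-≤-0≤ (h * h) (0≤² h) (energy-≤ q)) ⟩
    T * T * ((h + h) * redBlueCherries) + h * h * ((h ^ℚ q) * (h ^ℚ q) * ((h + h) * redBlueCherries))
      ≡⟨ solve 3 (λ h p d → h :* p :* (h :* p) :* ((h :+ h) :* d) :+ h :* h :* (p :* p :* ((h :+ h) :* d))
            := (h :* (h :* p) :+ h :* (h :* p)) :* ((h :* p :+ h :* p) :* d)) refl h (h ^ℚ q) redBlueCherries ⟩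
    k * ((T + T) * redBlueCherries) ∎)
    where
    open ≤-Reasoning
    T = h ^ℚ suc q
    k = h * T + h * T
    hT⁺ = Q.positive (^ℚ-pos 0<h (2 ℕ.+ q))

  -- From imbalance to the theorem.

  imbalance≡ : imbalance G ≡ ∑ V (λ x → ∣ δ x ∣)
  imbalance≡ = ∑-cong V λ x → cong (λ r → ∣ r - h ∣) (dR≡deg x)

  redBlueCherries-≤ : ∀ {ε} → 0ℚ Q.≤ ε → 0ℚ Q.≤ h → Unbalanced ε G → redBlueCherries Q.≤ ℕ→ℚ n * (h * h - ε * h * (ε * h))
  redBlueCherries-≤ {ε} 0≤ε 0≤h unbalanced = begin
    ∑ V (λ x → h * h - δ x * δ x)
      ≤⟨ ∑-mono V tangent ⟩
    ∑ V (λ x → h * h + q * q + - (q + q) * ∣ δ x ∣)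
      ≡⟨ ∑-+ V (λ _ → h * h + q * q) (λ x → - (q + q) * ∣ δ x ∣) ⟩
    ∑ V (λ x → h * h + q * q) + ∑ V (λ x → - (q + q) * ∣ δ x ∣)
      ≡⟨ cong₂ _+_ (∑-const n (h * h + q * q)) (∑-*ˡ V (- (q + q)) (λ x → ∣ δ x ∣)) ⟩
    N * (h * h + q * q) + - (q + q) * I
      -- The coefficient of `I` is -2q ≤ 0, so `I` may be replaced by its lower bound Nq; then N(h²
      -- + q²) - 2q(Nq) = N(h² - q²).
      ≤⟨ ≤-byDifference ((q + q) * (I - ε * (N * h))) (0≤* (+-mono-≤ 0≤q 0≤q) (p≤q⇒0≤q-p large))
           (solve 4 (λ N h ε I → N :* (h :* h :+ ε :* h :* (ε :* h)) :+ (:- (ε :* h :+ ε :* h)) :* I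
               :+ (ε :* h :+ ε :* h) :* (I :- ε :* (N :* h)) := N :* (h :* h :- ε :* h :* (ε :* h))) refl N h ε I) ⟩
    N * (h * h - q * q) ∎
    where
    open ≤-Reasoning
    N = ℕ→ℚ n
    q = ε * h
    I = ∑ V (λ x → ∣ δ x ∣)
    0≤q : 0ℚ Q.≤ q
    0≤q = 0≤* 0≤ε 0≤h
    large : ε * (N * h) Q.≤ I
    large = <⇒≤ (subst₂ (λ a b → ε * a Q.< b) (ℕ→ℚ-C2 n) imbalance≡ unbalanced)
    -- δ² is bounded below by its tangent at |δ| = q, which replaces Cauchy-Schwarz for Σ|δ|.
    tangent : ∀ x → h * h - δ x * δ x Q.≤ h * h + q * q + - (q + q) * ∣ δ x ∣
    tangent x = ≤-byDifference ((∣ δ x ∣ - q) * (∣ δ x ∣ - q)) (0≤² (∣ δ x ∣ - q))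
      (trans (cong (λ s → h * h - s + (∣ δ x ∣ - q) * (∣ δ x ∣ - q)) (sym (∣p∣*∣p∣≡p*p (δ x))))
        (solve 3 (λ h q d → h :* h :- d :* d :+ (d :- q) :* (d :- q) := h :* h :+ q :* q :+ (:- (q :+ q)) :* d) refl h q ∣ δ x ∣))

-- For n ≤ 1 both the imbalance and n C 2 are zero, against the strict inequality.
unbalanced⇒0<half : ∀ {n} ε (G : RedBlueK n) → Unbalanced ε G → 0ℚ Q.< half n
unbalanced⇒0<half {zero}        ε G unbalanced = ⊥-elim (<-irrefl refl (subst (Q._< 0ℚ) (*-zeroʳ ε) unbalanced))
unbalanced⇒0<half {suc zero}    ε G unbalanced = ⊥-elim (<-irrefl refl (subst (Q._< 0ℚ) (*-zeroʳ ε) unbalanced))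
unbalanced⇒0<half {suc (suc m)} ε G unbalanced =
  positive⁻¹ _ {{pos*pos⇒pos (ℕ→ℚ (2 ℕ.+ m) - 1ℚ) {{Q.positive 0<n-1}} ½}}
  where
  0<n-1 : 0ℚ Q.< ℕ→ℚ (2 ℕ.+ m) - 1ℚ
  0<n-1 = subst (0ℚ Q.<_)
    (trans (solve 1 (λ k → con 1ℚ :+ k := con 1ℚ :+ (con 1ℚ :+ k) :- con 1ℚ) refl (ℕ→ℚ m))
      (cong (_- 1ℚ) (sym (trans (ℕ→ℚ-suc (suc m)) (cong (1ℚ +_) (ℕ→ℚ-suc m))))))
    (+-mono-<-≤ (positive⁻¹ 1ℚ) (0≤ℕ→ℚ m))

open import Data.Integer using (+_)

theorem5p3 : (ε : ℚ) → 0ℚ Q.≤ ε → ε Q.≤ 1ℚ → (t : ℕ) → 2 ≤ t → (n : ℕ) → (G : RedBlueK n) → Unbalanced ε G → ℕ→ℚ (altWalkCount G t) Q.≤ ((1ℚ - (ε ^ℚ 4) * (+ 1 / 4)) * ℕ→ℚ (2 Data.Nat.* n) * (((ℕ→ℚ n - 1ℚ) * ½) ^ℚ t))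
theorem5p3 ε 0≤ε ε≤1 (suc (suc q)) (s≤s (s≤s z≤n)) n G unbalanced = begin
  ℕ→ℚ (altWalkCount G (2 ℕ.+ q))
    ≡⟨ cong (λ t → ℕ→ℚ (altWalkCount G t)) (ℕₚ.+-comm 2 q) ⟩
  ℕ→ℚ (altWalkCount G (q ℕ.+ 2))
    ≤⟨ altWalkCount-≤ G 0<η q ⟩
  (P + P) * redBlueCherries G
    ≤⟨ *-monoˡ-≤-0≤ (P + P) (+-mono-≤ 0≤P 0≤P) (redBlueCherries-≤ G 0≤ε (<⇒≤ 0<η) unbalanced) ⟩
  (P + P) * (N * (η * η - ε * η * (ε * η)))
    ≤⟨ ≤-byDifference slack 0≤slack (solve 4 (λ P N η ε →
         (P :+ P) :* (N :* (η :* η :- ε :* η :* (ε :* η)))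
           :+ (P :+ P) :* (N :* (η :* η)) :* (ε :* ε :* ((con 1ℚ :+ ε) :* (con 1ℚ :- ε) :+ con (+ 3 / 4) :* (ε :* ε)))
           := (con 1ℚ :- (ε :* (ε :* (ε :* (ε :* con 1ℚ)))) :* con (+ 1 / 4)) :* (N :+ (N :+ con 0ℚ)) :* (η :* (η :* P)))
         refl P N η ε) ⟩
  (1ℚ - (ε ^ℚ 4) * (+ 1 / 4)) * (N + (N + 0ℚ)) * (η ^ℚ (2 ℕ.+ q))
    -- `2 * n` unfolds to `n + (n + 0)`, hence the trailing zero.
    ≡⟨ cong (λ k → (1ℚ - (ε ^ℚ 4) * (+ 1 / 4)) * k * (η ^ℚ (2 ℕ.+ q)))
         (sym (trans (ℕ→ℚ-+ n (n ℕ.+ 0)) (cong (λ k → N + k) (ℕ→ℚ-+ n 0)))) ⟩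
  (1ℚ - (ε ^ℚ 4) * (+ 1 / 4)) * ℕ→ℚ (2 ℕ.* n) * (η ^ℚ (2 ℕ.+ q)) ∎
  where
  open ≤-Reasoning
  N = ℕ→ℚ n
  η = half n
  P = η ^ℚ q
  0<η : 0ℚ Q.< η
  0<η = unbalanced⇒0<half ε G unbalanced
  0≤P : 0ℚ Q.≤ P
  0≤P = <⇒≤ (^ℚ-pos 0<η q)
  -- The bracket is the gap between 1 - ε⁴/4 and 1 - ε², namely ε²(1 - ε² + 3ε²/4), with 1 - ε²
  -- factored so that `ε≤1` shows its sign.
  slack = (P + P) * (N * (η * η)) * (ε * ε * ((1ℚ + ε) * (1ℚ - ε) + (+ 3 / 4) * (ε * ε)))
  0≤slack : 0ℚ Q.≤ slack
  0≤slack = 0≤* (0≤* (+-mono-≤ 0≤P 0≤P) (0≤* (0≤ℕ→ℚ n) (0≤² η)))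
    (0≤* (0≤² ε) (+-mono-≤ (0≤* (+-mono-≤ (nonNegative⁻¹ 1ℚ) 0≤ε) (p≤q⇒0≤q-p ε≤1)) (0≤* (nonNegative⁻¹ (+ 3 / 4)) (0≤² ε))))
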